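{- When $m=2$, there is a $6$-competitive deterministic algorithm for the parametrized metrical service system problem on general metrics. That is, for every metric space $(X,d)$ (with no requirement on the size of $X$ or on the structure of the metric) and every pair of non-empty sets $K_1,K_2\subseteq X$, there is a $6$-competitive deterministic online algorithm for the problem on $(X,d)$ with the two request types $K_1,K_2$.
   Context: Parametrized metrical service system (MSS): given are a metric space $(X,d)$ and a fixed collection of $m$ non-empty subsets $K_1,\dots,K_m$ of $X$ (the request types), known to the algorithm in advance. An instance consists of an initial state $s_0\in X$ and a sequence of requests $\boldsymbol\rho=(\rho_1,\rho_2,\dots)$, each $\rho_t\in\{K_1,\dots,K_m\}$, revealed one at a time. On arrival of $\rho_t$, the algorithm must choose a state $s_t\in\rho_t$ without knowledge of future requests. The cost of a solution is $\sum_{t\ge1}d(s_{t-1},s_t)$. Let $\mathrm{cost}^*(\boldsymbol\rho)$ be the minimum cost among all feasible (offline) solutions of $\boldsymbol\rho$. A deterministic online algorithm $\mathcal A$ is $c$-competitive (has competitive ratio $c$) if there is a constant $\beta$, independent of the input sequence (but possibly depending on the metric space), such that $\mathrm{cost}_{\mathcal A}(\boldsymbol\rho)\le c\cdot \mathrm{cost}^*(\boldsymbol\rho)+\beta$ for every input sequence $\boldsymbol\rho$.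
   Formalization: Assumes the minimum defining cost* is attained also for infinite request sequences (a solution none of whose prefixes exceeds a budget sufficing at every horizon); without this the claim fails for some infinite metric spaces. -}

module Defs where

open import Level using (Level; _⊔_) renaming (suc to lsuc)
open import Data.Fin.Base using (Fin)
open import Data.List.Base using (List; applyUpTo)
open import Data.Nat.Base using (ℕ; zero; suc)
open import Data.Product.Base using (∃; ∃-syntax; _×_)
open import Data.Sum.Base using (_⊎_)
open import Function.Base using (_∘_)
open import Function.Bundles using (_⇔_)
open import Relation.Binary.Core using (Rel)
open import Relation.Binary.PropositionalEquality.Core using (_≡_)
open import Relation.Binary.Structures using (IsTotalOrder)
open import Relation.Nullary.Negation.Core using (¬_)
open import Relation.Unary using (Pred; _∈_; Satisfiable)
open import Algebra.Bundles using (CommutativeRing)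
import Algebra.Properties.Monoid.Mult as Mult

private
  variable
    c ℓ₁ ℓ₂ a k : Level

-- The real numbers, axiomatised as a Dedekind-complete ordered field. Under
-- excluded middle these axioms determine ℝ up to isomorphism.
record Reals c ℓ₁ ℓ₂ : Set (lsuc (c ⊔ ℓ₁ ⊔ ℓ₂)) where
  infix 4 _≤_
  field
    commutativeRing : CommutativeRing c ℓ₁
  open CommutativeRing commutativeRing public
  field
    _≤_          : Rel Carrier ℓ₂
    isTotalOrder : IsTotalOrder _≈_ _≤_
    1≉0          : ¬ (1# ≈ 0#)
    inverse      : ∀ x → ¬ (x ≈ 0#) → ∃[ y ] (x * y ≈ 1#)
    +-monoˡ-≤    : ∀ z {x y} → x ≤ y → x + z ≤ y + z
    *-nonneg     : ∀ {x y} → 0# ≤ x → 0# ≤ y → 0# ≤ x * y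

  UpperBound : Pred Carrier (c ⊔ ℓ₁ ⊔ ℓ₂) → Carrier → Set _
  UpperBound P u = ∀ x → x ∈ P → x ≤ u

  field
    complete : (P : Pred Carrier (c ⊔ ℓ₁ ⊔ ℓ₂)) → Satisfiable P → ∃ (UpperBound P) →
               ∃[ u ] (UpperBound P u × (∀ v → UpperBound P v → u ≤ v))

  fromℕ : ℕ → Carrier
  fromℕ n = n ×ᵐ 1#
    where open Mult +-monoid renaming (_×_ to _×ᵐ_)

record MetricSpace (ℝ : Reals c ℓ₁ ℓ₂) a : Set (c ⊔ ℓ₁ ⊔ ℓ₂ ⊔ lsuc a) where
  open Reals ℝ using (Carrier; _≈_; _≤_; _+_; 0#)
  field
    Point    : Set a
    d        : Point → Point → Carrier
    nonneg   : ∀ x y → 0# ≤ d x y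
    d≈0⇔≡    : ∀ x y → d x y ≈ 0# ⇔ x ≡ y
    d-sym    : ∀ x y → d x y ≈ d y x
    triangle : ∀ x y z → d x z ≤ d x y + d y z

-- The service system with request types K zero , … , K (m - 1). A request is
-- given by the index of its type.
--
-- Finite inputs and offline solutions are represented by infinite sequences
-- together with a horizon T: the input is ρ 0 , … , ρ (T - 1), and ρ t is served
-- in state s t, so that s 0 serves the first request and the initial state s₀ is
-- not part of s. As every request type is non-empty, a solution of the first T
-- requests always extends to all of ρ.
module MSS {ℝ : Reals c ℓ₁ ℓ₂} (M : MetricSpace ℝ a)
           {m : ℕ} (K : Fin m → Pred (MetricSpace.Point M) k) where
  open Reals ℝ using (Carrier; _≈_; _≤_; _+_; _*_; 0#)
  open MetricSpace M using (Point; d)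

  Feasible : (ℕ → Fin m) → (ℕ → Point) → Set k
  Feasible ρ s = ∀ t → s t ∈ K (ρ t)

  cost : Point → (ℕ → Point) → ℕ → Carrier
  cost s₀ s zero    = 0#
  cost s₀ s (suc T) = d s₀ (s 0) + cost (s 0) (s ∘ suc) T

  -- v = cost*(ρ 0 , … , ρ (T - 1)) from the initial state s₀.
  IsMinimumCost : Point → (ℕ → Fin m) → ℕ → Carrier → Set (a ⊔ k ⊔ ℓ₁ ⊔ ℓ₂)
  IsMinimumCost s₀ ρ T v =
    (∃[ s ] (Feasible ρ s × cost s₀ s T ≈ v)) ×
    (∀ s → Feasible ρ s → v ≤ cost s₀ s T)

  -- The state moved to depends on the initial state, the past requests
  -- (earliest first) and the current request only.
  record OnlineAlgorithm : Set (a ⊔ k) where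
    field
      next   : Point → List (Fin m) → Fin m → Point
      next∈K : ∀ s₀ past r → next s₀ past r ∈ K r

    run : Point → (ℕ → Fin m) → ℕ → Point
    run s₀ ρ t = next s₀ (applyUpTo ρ t) (ρ t)

  -- β may depend on the metric space, the request types and the algorithm, but
  -- neither on the requests nor on the initial state.
  Competitive : Carrier → OnlineAlgorithm → Set _
  Competitive γ A =
    ∃[ β ] (∀ s₀ ρ T v → IsMinimumCost s₀ ρ T v →
            cost s₀ (OnlineAlgorithm.run A s₀ ρ) T ≤ γ * v + β)

  -- s is an optimal offline solution of the infinite sequence ρ: its total cost,
  -- in [0,∞], is the supremum over T of the optimal costs of the first T
  -- requests, which no solution of ρ can undercut.
  IsOptimal : Point → (ℕ → Fin m) → (ℕ → Point) → Set _
  IsOptimal s₀ ρ s =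
    Feasible ρ s ×
    (∀ C → (∀ T → ∃[ s′ ] (Feasible ρ s′ × cost s₀ s′ T ≤ C)) →
           ∀ T → cost s₀ s T ≤ C)

  -- The minimum defining cost* is attained, for infinite inputs as well. The case
  -- of ρ eventually constant gives a minimum in the sense of IsMinimumCost for
  -- every finite input, since repeating the last request costs nothing.
  --
  -- This always holds when Point is finite, or when closed bounded sets are
  -- compact and each K i is closed. Without it the minima may exist for all
  -- finite inputs and yet no algorithm be competitive for any ratio: take points
  -- o and aₙ, bₙ (n ≥ 2) with d(o,aₙ) = d(o,bₙ) = 1 - 1/n, d(aₙ,bₙ) = 1/n², all
  -- other distances through o, and types {aₙ}, {bₙ}. Alternating requests from o
  -- have cost* < 1 at every horizon, but every infinite solution has infinite cost.
  OptimaAttained : Set _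
  OptimaAttained = ∀ s₀ ρ → ∃[ s ] IsOptimal s₀ ρ s

-- With two request types the only uncertainty is the horizon: repeated requests
-- are served by not moving, so an input amounts to its first request and its
-- number of changes. For a known sequence with unknown horizon, follow an optimal
-- solution of budget 2ʲ for as long as the horizon is affordable within 2ʲ, then
-- switch, at worst via s₀, to one of the least sufficient budget 2ʲ'. Each
-- abandoned phase j costs at most 2 · 2ʲ, so the total is at most 3 · 2ʲ in the
-- current phase j, and if j > 0 then 2ʲ⁻¹ was insufficient: 3 · 2ʲ ≤ 6 · cost*.
-- Phase 0 is absorbed by β = 3.
module Submission where

open import Defs
open import Level using (Level; _⊔_; Lift; lift; lower)
open import Axiom.ExcludedMiddle using (ExcludedMiddle)
import Algebra.Properties.Ring as RingProperties
import Algebra.Solver.Ring.NaturalCoefficients.Default as SemiringSolver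
open import Data.Empty using (⊥-elim)
open import Data.Fin.Base using (Fin; zero; suc; opposite)
open import Data.Fin.Properties using (_≟_)
open import Data.List.Base using (List; []; _∷_; applyUpTo)
open import Data.Nat.Base as ℕ using (ℕ; zero; suc; z≤n; s≤s)
import Data.Nat.Properties as ℕ
open import Data.Product.Base using (∃-syntax; _×_; _,_; proj₁; proj₂)
open import Data.Sum.Base using (inj₁; inj₂; fromInj₂)
open import Function.Base using (_∘_)
open import Function.Bundles using (Equivalence)
import Relation.Binary.Reasoning.PartialOrder as PartialOrderReasoning
open import Relation.Binary.Bundles using (Poset)
open import Relation.Binary.PropositionalEquality as ≡ using (_≡_; _≢_)
open import Relation.Binary.Structures using (module IsTotalOrder)
open import Relation.Nullary using (¬_; Dec; yes; no; contradiction)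
open import Relation.Nullary.Decidable using (map′; decidable-stable; ¬?)
open import Relation.Unary using (Pred; Satisfiable; Decidable)

private
  variable
    c ℓ₁ ℓ₂ a k p : Level

-- Excluded middle across levels, least witnesses, sequences.

lowerExcludedMiddle : ∀ q → ExcludedMiddle (p ⊔ q) → ExcludedMiddle p
lowerExcludedMiddle q em {P} = map′ lower lift (em {Lift q P})

least : {P : Pred ℕ p} → Decidable P → ∀ n → P n →
        ∃[ m ] (P m × (∀ {i} → P i → m ℕ.≤ i))
least P? zero P0 = 0 , P0 , λ _ → z≤n
least {P = P} P? (suc n) Pn with P? 0
... | yes P0 = 0 , P0 , λ _ → z≤n
... | no ¬P0 = let m , Pm , m≤ = least (P? ∘ suc) n Pn in suc m , Pm , bound m≤
  where
  bound : ∀ {m} → (∀ {i} → P (suc i) → m ℕ.≤ i) → ∀ {i} → P i → suc m ℕ.≤ i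
  bound m≤ {zero}  P0 = contradiction P0 ¬P0
  bound m≤ {suc i} Pi = s≤s (m≤ Pi)

infixr 5 _◂_
_◂_ : {A : Set a} → A → (ℕ → A) → ℕ → A
(x ◂ s) zero    = x
(x ◂ s) (suc t) = s t

-- Ordered-field arithmetic and powers of two.

module RealsProperties (ℝ : Reals c ℓ₁ ℓ₂) where
  open Reals ℝ
  open IsTotalOrder isTotalOrder public
    using (isPartialOrder; total)
    renaming (refl to ≤-refl; reflexive to ≤-reflexive; trans to ≤-trans)

  poset : Poset c ℓ₁ ℓ₂
  poset = record { isPartialOrder = isPartialOrder }

  module ≤-Reasoning = PartialOrderReasoning poset
  open ≤-Reasoning

  +-monoʳ-≤ : ∀ z {x y} → x ≤ y → z + x ≤ z + y
  +-monoʳ-≤ z {x} {y} x≤y = begin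
    z + x  ≈⟨ +-comm z x ⟩
    x + z  ≤⟨ +-monoˡ-≤ z x≤y ⟩
    y + z  ≈⟨ +-comm y z ⟩
    z + y  ∎

  +-mono-≤ : ∀ {x y z w} → x ≤ y → z ≤ w → x + z ≤ y + w
  +-mono-≤ x≤y z≤w = ≤-trans (+-monoˡ-≤ _ x≤y) (+-monoʳ-≤ _ z≤w)

  x≤x+y : ∀ x {y} → 0# ≤ y → x ≤ x + y
  x≤x+y x {y} 0≤y = begin
    x       ≈⟨ +-identityʳ x ⟨
    x + 0#  ≤⟨ +-monoʳ-≤ x 0≤y ⟩
    x + y   ∎

  x≤y+x : ∀ x {y} → 0# ≤ y → x ≤ y + x
  x≤y+x x {y} 0≤y = ≤-trans (x≤x+y x 0≤y) (≤-reflexive (+-comm x y))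

  0≤1 : 0# ≤ 1#
  0≤1 with total 0# 1#
  ... | inj₁ 0≤1 = 0≤1
  ... | inj₂ 1≤0 = begin
    0#              ≤⟨ *-nonneg 0≤-1 0≤-1 ⟩
    - 1# * - 1#     ≈⟨ -1*x≈-x (- 1#) ⟩
    - (- 1#)        ≈⟨ -‿involutive 1# ⟩
    1#              ∎
    where
    open RingProperties ring using (-1*x≈-x; -‿involutive)
    0≤-1 : 0# ≤ - 1#
    0≤-1 = begin
      0#           ≈⟨ -‿inverseʳ 1# ⟨
      1# + - 1#    ≤⟨ +-monoˡ-≤ (- 1#) 1≤0 ⟩
      0# + - 1#    ≈⟨ +-identityˡ (- 1#) ⟩
      - 1#         ∎

  0≤fromℕ : ∀ n → 0# ≤ fromℕ n
  0≤fromℕ zero    = ≤-refl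
  0≤fromℕ (suc n) = ≤-trans 0≤1 (x≤x+y _ (0≤fromℕ n))

  fromℕ-*-monoʳ-≤ : ∀ n {x y} → x ≤ y → fromℕ n * x ≤ fromℕ n * y
  fromℕ-*-monoʳ-≤ zero    {x} {y} _   = ≤-reflexive (trans (zeroˡ x) (sym (zeroˡ y)))
  fromℕ-*-monoʳ-≤ (suc n) {x} {y} x≤y = begin
    (1# + fromℕ n) * x       ≈⟨ distribʳ x 1# (fromℕ n) ⟩
    1# * x + fromℕ n * x     ≈⟨ +-congʳ (*-identityˡ x) ⟩
    x + fromℕ n * x          ≤⟨ +-mono-≤ x≤y (fromℕ-*-monoʳ-≤ n x≤y) ⟩
    y + fromℕ n * y          ≈⟨ +-congʳ (*-identityˡ y) ⟨
    1# * y + fromℕ n * y     ≈⟨ distribʳ y 1# (fromℕ n) ⟨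
    (1# + fromℕ n) * y       ∎

  2^_ : ℕ → Carrier
  2^ zero  = 1#
  2^ suc j = 2^ j + 2^ j

  1≤2^ : ∀ j → 1# ≤ 2^ j
  1≤2^ zero    = ≤-refl
  1≤2^ (suc j) = ≤-trans (1≤2^ j) (x≤x+y _ (≤-trans 0≤1 (1≤2^ j)))

  0≤2^ : ∀ j → 0# ≤ 2^ j
  0≤2^ j = ≤-trans 0≤1 (1≤2^ j)

  2^-mono : ∀ {i j} → i ℕ.≤ j → 2^ i ≤ 2^ j
  2^-mono {j = j} z≤n = 1≤2^ j
  2^-mono (s≤s i≤j)   = +-mono-≤ (2^-mono i≤j) (2^-mono i≤j)

  -- If u is the least upper bound of the powers, then 2ʲ + 1 ≤ 2ʲ⁺¹ ≤ u makes
  -- u - 1 an upper bound as well.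
  2^-unbounded : ∀ {x} → ¬ (∀ j → 2^ j ≤ x)
  2^-unbounded {x} 2^≤x = 1≉0 (IsTotalOrder.antisym isTotalOrder 1≤0 0≤1)
    where
    IsPower : Pred Carrier (c ⊔ ℓ₁ ⊔ ℓ₂)
    IsPower y = Lift (c ⊔ ℓ₁ ⊔ ℓ₂) (∃[ j ] y ≈ 2^ j)

    supremum : ∃[ u ] (UpperBound IsPower u × (∀ v → UpperBound IsPower v → u ≤ v))
    supremum = complete IsPower (1# , lift (0 , refl))
      (x , λ { y (lift (j , y≈)) → ≤-trans (≤-reflexive y≈) (2^≤x j) })

    u : Carrier
    u = proj₁ supremum

    u-1-bound : UpperBound IsPower (u + - 1#)
    u-1-bound y (lift (j , y≈)) = begin
      y                    ≈⟨ y≈ ⟩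
      2^ j                 ≈⟨ +-identityʳ _ ⟨
      2^ j + 0#            ≈⟨ +-congˡ (-‿inverseʳ 1#) ⟨
      2^ j + (1# + - 1#)   ≈⟨ +-assoc _ _ _ ⟨
      2^ j + 1# + - 1#     ≤⟨ +-monoˡ-≤ _ (+-monoʳ-≤ _ (1≤2^ j)) ⟩
      2^ suc j + - 1#      ≤⟨ +-monoˡ-≤ _ (proj₁ (proj₂ supremum) _ (lift (suc j , refl))) ⟩
      u + - 1#             ∎

    1≤0 : 1# ≤ 0#
    1≤0 = begin
      1#                      ≈⟨ +-identityˡ 1# ⟨
      0# + 1#                 ≈⟨ +-congʳ (-‿inverseʳ u) ⟨
      u + - u + 1#            ≤⟨ +-monoˡ-≤ _ (+-monoˡ-≤ _ (proj₂ (proj₂ supremum) _ u-1-bound)) ⟩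
      u + - 1# + - u + 1#     ≈⟨ +-congʳ (+-congʳ (+-comm u (- 1#))) ⟩
      - 1# + u + - u + 1#     ≈⟨ +-congʳ (+-assoc (- 1#) u (- u)) ⟩
      - 1# + (u + - u) + 1#   ≈⟨ +-congʳ (+-congˡ (-‿inverseʳ u)) ⟩
      - 1# + 0# + 1#          ≈⟨ +-congʳ (+-identityʳ (- 1#)) ⟩
      - 1# + 1#               ≈⟨ -‿inverseˡ 1# ⟩
      0#                      ∎

  -- Supplies a sufficient budget for any cost. The existential ranges over `ℕ`, so excluded middle
  -- at the level of the order decides it.
  archimedean : ExcludedMiddle ℓ₂ → ∀ x → ∃[ j ] x ≤ 2^ j
  archimedean em x with em {∃[ j ] x ≤ 2^ j}
  ... | yes x≤2^ = x≤2^
  ... | no ¬x≤2^ = ⊥-elim (2^-unbounded 2^≤x)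
    where
    2^≤x : ∀ j → 2^ j ≤ x
    2^≤x j = fromInj₂ (λ x≤2^j → contradiction (j , x≤2^j) ¬x≤2^) (total x (2^ j))

-- Costs of solutions, for any number of request types.

module MSSProperties {ℝ : Reals c ℓ₁ ℓ₂} (M : MetricSpace ℝ a)
                     {m : ℕ} (K : Fin m → Pred (MetricSpace.Point M) k) where
  open Reals ℝ
  open RealsProperties ℝ
  open ≤-Reasoning
  open MetricSpace M
  open MSS M K

  dₓₓ≈0 : ∀ x → d x x ≈ 0#
  dₓₓ≈0 x = Equivalence.from (d≈0⇔≡ x x) ≡.refl

  cost-nonneg : ∀ x s T → 0# ≤ cost x s T
  cost-nonneg x s zero    = ≤-refl
  cost-nonneg x s (suc T) = ≤-trans (nonneg x (s 0)) (x≤x+y _ (cost-nonneg (s 0) (s ∘ suc) T))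

  cost-mono-≤ : ∀ x s {T U} → T ℕ.≤ U → cost x s T ≤ cost x s U
  cost-mono-≤ x s {U = U} z≤n = cost-nonneg x s U
  cost-mono-≤ x s (s≤s T≤U)   = +-monoʳ-≤ _ (cost-mono-≤ (s 0) (s ∘ suc) T≤U)

  -- `cost` unfolds at the front, whereas the online analysis appends moves at the end. The horizon
  -- starts at two because the first move leaves from `x`, not from a state of `s`.
  cost-last : ∀ x s T → cost x s (2 ℕ.+ T) ≈ cost x s (1 ℕ.+ T) + d (s T) (s (suc T))
  cost-last x s zero    = trans (+-congˡ (+-identityʳ _)) (+-congʳ (sym (+-identityʳ _)))
  cost-last x s (suc T) =
    trans (+-congˡ (cost-last (s 0) (s ∘ suc) T)) (sym (+-assoc _ _ _))

  -- Triangle inequality along the path. It pays for the detour via `s₀` when the phase changes.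
  d≤cost : ∀ x s T → d x (s T) ≤ cost x s (suc T)
  d≤cost x s zero    = x≤x+y _ ≤-refl
  d≤cost x s (suc T) = ≤-trans (triangle x (s 0) _) (+-monoʳ-≤ _ (d≤cost (s 0) (s ∘ suc) T))

  cost-start : ∀ x y s T → cost x s (suc T) ≤ d x y + cost y s (suc T)
  cost-start x y s T = begin
    d x (s 0) + _              ≤⟨ +-monoˡ-≤ _ (triangle x y (s 0)) ⟩
    d x y + d y (s 0) + _      ≈⟨ +-assoc _ _ _ ⟩
    d x y + cost y s (suc T)   ∎

  -- ρ is known in advance, but not the horizon.
  module Doubling (em : ExcludedMiddle (a ⊔ k ⊔ ℓ₂)) (em₂ : ExcludedMiddle ℓ₂)
                  (attained : OptimaAttained)
                  (s₀ : Point) (ρ : ℕ → Fin m) where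

    -- Compares the optimal cost with a budget through a witness, without naming the minimum.
    Affordable : Carrier → ℕ → Set (a ⊔ k ⊔ ℓ₂)
    Affordable C T = ∃[ s ] (Feasible ρ s × cost s₀ s T ≤ C)

    affordable? : ∀ C → Decidable (Affordable C)
    affordable? C T = em

    affordable-anti : ∀ {C T U} → T ℕ.≤ U → Affordable C U → Affordable C T
    affordable-anti T≤U (s , feasible , s≤C) = s , feasible , ≤-trans (cost-mono-≤ s₀ s T≤U) s≤C

    affordable-< : ∀ {C} T U → Affordable C T → ¬ Affordable C U → T ℕ.< U
    affordable-< T U affT ¬affU = ℕ.≰⇒> λ U≤T → ¬affU (affordable-anti U≤T affT)

    affordable-0 : ∀ {C} → 0# ≤ C → Affordable C 0
    affordable-0 0≤C = let s , feasible , _ = attained s₀ ρ in s , feasible , 0≤C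

    -- One solution handles all affordable horizons at once. If every horizon is affordable, the
    -- optimum of the infinite input does so, by the supremum clause of `IsOptimal`; otherwise a
    -- solution for the last affordable horizon does, since costs grow with the horizon.
    plan : ∀ {C} → 0# ≤ C → ∃[ s ] (Feasible ρ s × (∀ T → Affordable C T → cost s₀ s T ≤ C))
    plan {C} 0≤C with em {∃[ T ] ¬ Affordable C T}
    ... | no ∄T =
      let s , feasible , optimal = attained s₀ ρ
          always U = decidable-stable (affordable? C U) λ ¬aff → ∄T (U , ¬aff)
      in s , feasible , λ T _ → optimal C always T
    ... | yes (U , ¬affU) with least (¬? ∘ affordable? C) U ¬affU
    ...   | zero  , ¬aff0 , _  = contradiction (affordable-0 0≤C) ¬aff0
    -- `suc T` is the least unaffordable horizon, so `T` is affordable and bounds every affordable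
    -- `V`.
    ...   | suc T , ¬affT , T< =
      let s , feasible , s≤C = decidable-stable (affordable? C T) (ℕ.<-irrefl ≡.refl ∘ T<)
      in s , feasible , λ V affV →
           ≤-trans (cost-mono-≤ s₀ s (ℕ.s≤s⁻¹ (affordable-< V (suc T) affV ¬affT))) s≤C

    -- Depends on the budget but not on the horizon, so that it can be followed online.
    phasePlan : ℕ → ℕ → Point
    phasePlan j = proj₁ (plan (0≤2^ j))

    phasePlan-feasible : ∀ j → Feasible ρ (phasePlan j)
    phasePlan-feasible j = proj₁ (proj₂ (plan (0≤2^ j)))

    phasePlan-cost : ∀ j T → Affordable (2^ j) T → cost s₀ (phasePlan j) T ≤ 2^ j
    phasePlan-cost j = proj₂ (proj₂ (plan (0≤2^ j)))

    -- Serving request `t` makes the horizon `suc t`.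
    leastPhase : ∀ t → ∃[ j ] (Affordable (2^ j) (suc t) ×
                               (∀ {i} → Affordable (2^ i) (suc t) → j ℕ.≤ i))
    leastPhase t =
      let s , feasible , _ = attained s₀ ρ
          j , s≤2^j        = archimedean em₂ (cost s₀ s (suc t))
      in least (λ i → affordable? (2^ i) (suc t)) j (s , feasible , s≤2^j)

    phase : ℕ → ℕ
    phase t = proj₁ (leastPhase t)

    phase-affordable : ∀ t → Affordable (2^ phase t) (suc t)
    phase-affordable t = proj₁ (proj₂ (leastPhase t))

    phase-least : ∀ t {i} → Affordable (2^ i) (suc t) → phase t ℕ.≤ i
    phase-least t = proj₂ (proj₂ (leastPhase t))

    phase-step : ∀ t → phase t ℕ.≤ phase (suc t)
    phase-step t = phase-least t (affordable-anti (ℕ.n≤1+n (suc t)) (phase-affordable (suc t)))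

    doubling : ℕ → Point
    doubling t = phasePlan (phase t) t

    doubling-feasible : Feasible ρ doubling
    doubling-feasible t = phasePlan-feasible (phase t) t

    open SemiringSolver commutativeSemiring using (solve; _:+_; _:*_; _:=_; con)

    -- The invariant of the amortisation: the power of two pays for all abandoned phases and for the
    -- switches, and the current phase is charged as if its plan had been followed from `s₀` since
    -- the beginning.
    doubling-cost : ∀ t → cost s₀ doubling (suc t) ≤
                          2^ suc (phase t) + cost s₀ (phasePlan (phase t)) (suc t)
    doubling-cost zero    = x≤y+x _ (0≤2^ (suc (phase 0)))
    doubling-cost (suc t) with ℕ.m≤n⇒m<n∨m≡n (phase-step t)
    -- Within a phase both sides grow by the same move.
    ... | inj₂ j≡j′ = begin
      cost s₀ doubling (2 ℕ.+ t)
        ≈⟨ cost-last s₀ doubling t ⟩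
      cost s₀ doubling (suc t) + d (doubling t) (doubling (suc t))
        ≤⟨ +-monoˡ-≤ _ (doubling-cost t) ⟩
      2^ suc j + cost s₀ (phasePlan j) (suc t) + d (doubling t) (doubling (suc t))
        ≡⟨ ≡.cong (λ i → 2^ suc i + cost s₀ (phasePlan i) (suc t)
                                  + d (phasePlan i t) (doubling (suc t)))
                 j≡j′ ⟩
      2^ suc j′ + cost s₀ (phasePlan j′) (suc t) + d (phasePlan j′ t) (phasePlan j′ (suc t))
        ≈⟨ +-assoc _ _ _ ⟩
      2^ suc j′ + (cost s₀ (phasePlan j′) (suc t) + d (phasePlan j′ t) (phasePlan j′ (suc t)))
        ≈⟨ +-congˡ (cost-last s₀ (phasePlan j′) t) ⟨
      2^ suc j′ + cost s₀ (phasePlan j′) (2 ℕ.+ t)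
        ∎
      where
      j  = phase t
      j′ = phase (suc t)
    ... | inj₁ j<j′ = begin
      cost s₀ doubling (2 ℕ.+ t)
        ≈⟨ cost-last s₀ doubling t ⟩
      cost s₀ doubling (suc t) + d x y
        -- The switch is routed through `s₀`: the way back costs at most `A`, the way out at most
        -- `B`, which is the new plan's whole cost.
        ≤⟨ +-mono-≤ (doubling-cost t) (triangle x s₀ y) ⟩
      2^ suc j + A + (d x s₀ + d s₀ y)
        ≤⟨ +-monoʳ-≤ _ (+-mono-≤ x≤A (d≤cost s₀ (phasePlan j′) (suc t))) ⟩
      2^ suc j + A + (A + B)
        ≈⟨ solve 3 (λ D A B → D :+ A :+ (A :+ B) := D :+ (A :+ A) :+ B) refl (2^ suc j) A B ⟩
      2^ suc j + (A + A) + B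
        ≤⟨ +-monoˡ-≤ B (+-monoʳ-≤ _ (+-mono-≤ A≤2^j A≤2^j)) ⟩
      2^ suc (suc j) + B
        -- Phases may be skipped, so `j′` can exceed `suc j`.
        ≤⟨ +-monoˡ-≤ B (2^-mono (s≤s j<j′)) ⟩
      2^ suc j′ + B
        ∎
      where
      j  = phase t
      j′ = phase (suc t)
      x  = doubling t
      y  = doubling (suc t)
      A  = cost s₀ (phasePlan j) (suc t)
      B  = cost s₀ (phasePlan j′) (2 ℕ.+ t)
      x≤A : d x s₀ ≤ A
      x≤A = ≤-trans (≤-reflexive (d-sym x s₀)) (d≤cost s₀ (phasePlan j) t)
      A≤2^j : A ≤ 2^ j
      A≤2^j = phasePlan-cost j (suc t) (phase-affordable t)

    -- Stated against every feasible solution, so that it applies to the one built by `collapse`,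
    -- whose optimality is not known.
    doubling-competitive : ∀ s → Feasible ρ s → ∀ t →
      cost s₀ doubling (suc t) ≤ fromℕ 6 * cost s₀ s (suc t) + fromℕ 3
    doubling-competitive s feasible t = begin
      cost s₀ doubling (suc t)
        ≤⟨ doubling-cost t ⟩
      2^ suc (phase t) + cost s₀ (phasePlan (phase t)) (suc t)
        ≤⟨ +-monoʳ-≤ _ (phasePlan-cost (phase t) (suc t) (phase-affordable t)) ⟩
      2^ suc (phase t) + 2^ phase t
        ≤⟨ bound (phase t) (phase-least t) ⟩
      fromℕ 6 * V + fromℕ 3
        ∎
      where
      V = cost s₀ s (suc t)

      bound : ∀ j → (∀ {i} → Affordable (2^ i) (suc t) → j ℕ.≤ i) →
              2^ suc j + 2^ j ≤ fromℕ 6 * V + fromℕ 3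
      bound zero _ = begin
        1# + 1# + 1#
          -- The right-hand side mirrors the unfolding of `fromℕ 3`, which ends in `0#`.
          ≈⟨ solve 0 (con 1 :+ con 1 :+ con 1 := con 1 :+ (con 1 :+ (con 1 :+ con 0))) refl ⟩
        fromℕ 3
          ≤⟨ x≤y+x _ (*-nonneg (0≤fromℕ 6) (cost-nonneg s₀ s (suc t))) ⟩
        fromℕ 6 * V + fromℕ 3
          ∎
      bound (suc i) i< = begin
        2^ suc (suc i) + 2^ suc i
          ≈⟨ solve 1 (λ B → B :+ B :+ (B :+ B) :+ (B :+ B) :=
               (con 1 :+ (con 1 :+ (con 1 :+ (con 1 :+ (con 1 :+ (con 1 :+ con 0)))))) :* B)
               refl (2^ i) ⟩
        fromℕ 6 * 2^ i
          ≤⟨ fromℕ-*-monoʳ-≤ 6 2^i≤V ⟩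
        fromℕ 6 * V
          ≤⟨ x≤x+y _ (0≤fromℕ 3) ⟩
        fromℕ 6 * V + fromℕ 3
          ∎
        where
        2^i≤V : 2^ i ≤ V
        -- Were `V` at most the budget of phase `i`, then `s` itself would make that phase
        -- affordable, against the minimality of `suc i`.
        2^i≤V = fromInj₂ (λ V≤2^i → contradiction (i< (s , feasible , V≤2^i)) (ℕ.<-irrefl ≡.refl))
                         (total V (2^ i))

-- Inputs with two types, up to repetition.

first : Fin 2 → List (Fin 2) → Fin 2
first r []      = r
first r (p ∷ _) = p

-- The past is listed earliest first, so each `p` is compared with its successor. That is
-- `first r past`, where the current request `r` is the default that ends the list.
changes : List (Fin 2) → Fin 2 → ℕ
changes []         r = 0
changes (p ∷ past) r with p ≟ first r past
... | yes _ = changes past r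
... | no  _ = suc (changes past r)

alternate : Fin 2 → ℕ → Fin 2
alternate i zero    = i
alternate i (suc n) = alternate (opposite i) n

-- This is where two types matter: a change leaves only one possible next type.
≢⇒opposite≡ : ∀ {i j : Fin 2} → i ≢ j → opposite i ≡ j
≢⇒opposite≡ {zero}     {zero}     i≢j = contradiction ≡.refl i≢j
≢⇒opposite≡ {zero}     {suc zero} _   = ≡.refl
≢⇒opposite≡ {suc zero} {zero}     _   = ≡.refl
≢⇒opposite≡ {suc zero} {suc zero} i≢j = contradiction ≡.refl i≢j

-- Every change flips the type and every repetition keeps it. Hence a state that serves the
-- alternating input at this index also serves `r`.
alternate-changes : ∀ past r → alternate (first r past) (changes past r) ≡ r
alternate-changes []         r = ≡.refl
alternate-changes (p ∷ past) r with p ≟ first r past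
... | yes p≡ = ≡.trans (≡.cong (λ i → alternate i (changes past r)) p≡) (alternate-changes past r)
... | no  p≢ = ≡.trans (≡.cong (λ i → alternate i (changes past r)) (≢⇒opposite≡ p≢))
                       (alternate-changes past r)

first-applyUpTo : ∀ (ρ : ℕ → Fin 2) t → first (ρ t) (applyUpTo ρ t) ≡ ρ 0
first-applyUpTo ρ zero    = ≡.refl
first-applyUpTo ρ (suc t) = ≡.refl

changesAt : (ℕ → Fin 2) → ℕ → ℕ
changesAt ρ t = changes (applyUpTo ρ t) (ρ t)

changesAt-≡ : ∀ ρ → ρ 0 ≡ ρ 1 → ∀ t → changesAt ρ (suc t) ≡ changesAt (ρ ∘ suc) t
changesAt-≡ ρ eq t with ρ 0 ≟ first (ρ (suc t)) (applyUpTo (ρ ∘ suc) t)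
... | yes _ = ≡.refl
... | no ≢  = contradiction (≡.trans eq (≡.sym (first-applyUpTo (ρ ∘ suc) t))) ≢

changesAt-≢ : ∀ ρ → ρ 0 ≢ ρ 1 → ∀ t → changesAt ρ (suc t) ≡ suc (changesAt (ρ ∘ suc) t)
changesAt-≢ ρ ρ0≢ρ1 t with ρ 0 ≟ first (ρ (suc t)) (applyUpTo (ρ ∘ suc) t)
... | yes eq = contradiction (≡.trans eq (first-applyUpTo (ρ ∘ suc) t)) ρ0≢ρ1
... | no _   = ≡.refl

-- Reduction of arbitrary inputs to alternating ones.

module TwoRequestTypes {ℝ : Reals c ℓ₁ ℓ₂} (M : MetricSpace ℝ a)
                       (K : Fin 2 → Pred (MetricSpace.Point M) k)
                       (nonempty : ∀ i → Satisfiable (K i)) where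
  open Reals ℝ
  open RealsProperties ℝ
  open ≤-Reasoning
  open MetricSpace M
  open MSS M K
  open MSSProperties M K

  cost-cong : ∀ x {s s′} → (∀ t → s t ≡ s′ t) → ∀ T → cost x s T ≡ cost x s′ T
  cost-cong x s≗s′ zero    = ≡.refl
  cost-cong x s≗s′ (suc T) rewrite s≗s′ 0 = ≡.cong (_ +_) (cost-cong _ (s≗s′ ∘ suc) T)

  -- Repetitions are served by standing still, for free. Since the index counts changes from 0, the
  -- horizon is one more than their number.
  cost-∘changes : ∀ ρ x s T →
                  cost x (s ∘ changesAt ρ) (suc T) ≈ cost x s (suc (changesAt ρ T))
  cost-∘changes ρ x s zero    = refl
  cost-∘changes ρ x s (suc T) = step (ρ 0 ≟ ρ 1)
    where
    step : Dec (ρ 0 ≡ ρ 1) →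
           cost x (s ∘ changesAt ρ) (2 ℕ.+ T) ≈ cost x s (suc (changesAt ρ (suc T)))
    step (yes eq) = begin-equality
      d x (s 0) + cost (s 0) (s ∘ changesAt ρ ∘ suc) (suc T)
        ≡⟨ ≡.cong (d x (s 0) +_) (cost-cong (s 0) (≡.cong s ∘ changesAt-≡ ρ eq) (suc T)) ⟩
      d x (s 0) + cost (s 0) (s ∘ changesAt (ρ ∘ suc)) (suc T)
        ≈⟨ +-congˡ (cost-∘changes (ρ ∘ suc) (s 0) s T) ⟩
      -- The tail is served by the same `s`, now from `s 0`, so its first move has length zero.
      d x (s 0) + (d (s 0) (s 0) + cost (s 0) (s ∘ suc) (changesAt (ρ ∘ suc) T))
        ≈⟨ +-congˡ (trans (+-congʳ (dₓₓ≈0 (s 0))) (+-identityˡ _)) ⟩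
      cost x s (suc (changesAt (ρ ∘ suc) T))
        ≡⟨ ≡.cong (cost x s ∘ suc) (changesAt-≡ ρ eq T) ⟨
      cost x s (suc (changesAt ρ (suc T)))
        ∎
    step (no ρ0≢ρ1) = begin-equality
      d x (s 0) + cost (s 0) (s ∘ changesAt ρ ∘ suc) (suc T)
        ≡⟨ ≡.cong (d x (s 0) +_) (cost-cong (s 0) (≡.cong s ∘ changesAt-≢ ρ ρ0≢ρ1) (suc T)) ⟩
      d x (s 0) + cost (s 0) (s ∘ suc ∘ changesAt (ρ ∘ suc)) (suc T)
        ≈⟨ +-congˡ (cost-∘changes (ρ ∘ suc) (s 0) (s ∘ suc) T) ⟩
      cost x s (2 ℕ.+ changesAt (ρ ∘ suc) T)
        ≡⟨ ≡.cong (cost x s ∘ suc) (changesAt-≢ ρ ρ0≢ρ1 T) ⟨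
      cost x s (suc (changesAt ρ (suc T)))
        ∎

  -- The converse direction, for offline solutions: keep the last state of each block of equal
  -- requests within the horizon. Skipping the others cannot increase the cost, by the triangle
  -- inequality.
  collapse : ∀ ρ x s → Feasible ρ s → ∀ T →
    ∃[ s′ ] (Feasible (alternate (ρ 0)) s′ ×
             cost x s′ (suc (changesAt ρ T)) ≤ cost x s (suc T))
  collapse ρ x s feasible zero =
    -- Beyond the horizon any points of the right types will do; non-emptiness provides them.
    s 0 ◂ (λ n → proj₁ (nonempty (alternate (opposite (ρ 0)) n))) ,
    (λ { zero    → feasible 0
       ; (suc n) → proj₂ (nonempty (alternate (opposite (ρ 0)) n)) }) ,
    ≤-refl
  collapse ρ x s feasible (suc T)
    with ρ 0 ≟ ρ 1 | collapse (ρ ∘ suc) (s 0) (s ∘ suc) (feasible ∘ suc) T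
  ... | yes eq | s′ , feasible′ , s′≤s =
    s′ ,
    (λ n → ≡.subst (λ i → K (alternate i n) (s′ n)) (≡.sym eq) (feasible′ n)) ,
    (begin
      cost x s′ (suc (changesAt ρ (suc T)))
        ≡⟨ ≡.cong (cost x s′ ∘ suc) (changesAt-≡ ρ eq T) ⟩
      cost x s′ (suc (changesAt (ρ ∘ suc) T))
        -- `s 0` is dropped here: `s′` starts with a state kept from the tail, reached directly from
        -- `x`.
        ≤⟨ cost-start x (s 0) s′ (changesAt (ρ ∘ suc) T) ⟩
      d x (s 0) + cost (s 0) s′ (suc (changesAt (ρ ∘ suc) T))
        ≤⟨ +-monoʳ-≤ _ s′≤s ⟩
      cost x s (2 ℕ.+ T)
        ∎)
  ... | no ρ0≢ρ1 | s′ , feasible′ , s′≤s =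
    s 0 ◂ s′ ,
    (λ { zero    → feasible 0
       ; (suc n) → ≡.subst (λ i → K (alternate i n) (s′ n)) (≡.sym (≢⇒opposite≡ ρ0≢ρ1))
                           (feasible′ n) }) ,
    (begin
      cost x (s 0 ◂ s′) (suc (changesAt ρ (suc T)))
        ≡⟨ ≡.cong (cost x (s 0 ◂ s′) ∘ suc) (changesAt-≢ ρ ρ0≢ρ1 T) ⟩
      d x (s 0) + cost (s 0) s′ (suc (changesAt (ρ ∘ suc) T))
        ≤⟨ +-monoʳ-≤ _ s′≤s ⟩
      cost x s (2 ℕ.+ T)
        ∎)

  module _ (em : ExcludedMiddle (a ⊔ k ⊔ ℓ₂)) (em₂ : ExcludedMiddle ℓ₂)
           (attained : OptimaAttained) where
    open Doubling em em₂ attained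

    -- The first request fixes the whole alternating input, so the known-sequence strategy runs on
    -- it, with the number of changes so far as its clock.
    changesDoubling : OnlineAlgorithm
    changesDoubling = record
      { next   = λ s₀ past r → doubling s₀ (alternate (first r past)) (changes past r)
      ; next∈K = λ s₀ past r →
          let α = alternate (first r past)
              n = changes past r
          in ≡.subst (λ i → K i (doubling s₀ α n)) (alternate-changes past r)
                     (doubling-feasible s₀ α n)
      }

    changesDoubling-competitive : Competitive (fromℕ 6) changesDoubling
    changesDoubling-competitive = fromℕ 3 , bound
      where
      open OnlineAlgorithm changesDoubling using (run)

      bound : ∀ s₀ ρ T v → IsMinimumCost s₀ ρ T v →
              cost s₀ (run s₀ ρ) T ≤ fromℕ 6 * v + fromℕ 3
      bound s₀ ρ zero v ((s , feasible , 0≈v) , _) = begin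
        0#                     ≤⟨ 0≤fromℕ 3 ⟩
        fromℕ 3                ≈⟨ +-identityˡ _ ⟨
        0# + fromℕ 3           ≈⟨ +-congʳ (zeroʳ _) ⟨
        fromℕ 6 * 0# + fromℕ 3 ≈⟨ +-congʳ (*-congˡ 0≈v) ⟩
        fromℕ 6 * v + fromℕ 3  ∎
      bound s₀ ρ (suc T) v ((s , feasible , s≈v) , _) =
        let s′ , feasible′ , s′≤s = collapse ρ s₀ s feasible T in begin
        cost s₀ (run s₀ ρ) (suc T)
          ≡⟨ cost-cong s₀ (λ t → ≡.cong (λ i → doubling s₀ (alternate i) (changesAt ρ t))
                                        (first-applyUpTo ρ t)) (suc T) ⟩
        cost s₀ (doubling s₀ (alternate (ρ 0)) ∘ changesAt ρ) (suc T)
          ≈⟨ cost-∘changes ρ s₀ (doubling s₀ (alternate (ρ 0))) T ⟩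
        cost s₀ (doubling s₀ (alternate (ρ 0))) (suc (changesAt ρ T))
          ≤⟨ doubling-competitive s₀ (alternate (ρ 0)) s′ feasible′ (changesAt ρ T) ⟩
        fromℕ 6 * cost s₀ s′ (suc (changesAt ρ T)) + fromℕ 3
          ≤⟨ +-monoˡ-≤ _ (fromℕ-*-monoʳ-≤ 6 (≤-trans s′≤s (≤-reflexive s≈v))) ⟩
        fromℕ 6 * v + fromℕ 3
          ∎

mainTheorem5 : ∀ {c ℓ₁ ℓ₂ a k} → ExcludedMiddle (c ⊔ ℓ₁ ⊔ ℓ₂ ⊔ a ⊔ k) →
    (ℝ : Reals c ℓ₁ ℓ₂) (M : MetricSpace ℝ a) →
    (K : Fin 2 → Pred (MetricSpace.Point M) k) → (∀ i → Satisfiable (K i)) →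
    MSS.OptimaAttained M K →
    ∃[ A ] MSS.Competitive M K (Reals.fromℕ ℝ 6) A
mainTheorem5 {c} {ℓ₁} {ℓ₂} {a} {k} em ℝ M K nonempty attained =
  changesDoubling em₁ em₂ attained , changesDoubling-competitive em₁ em₂ attained
  where
  open TwoRequestTypes M K nonempty
  -- Affordability lives at this level, comparisons of reals at `ℓ₂`.
  em₁ : ExcludedMiddle (a ⊔ k ⊔ ℓ₂)
  em₁ = lowerExcludedMiddle (c ⊔ ℓ₁) em
  em₂ : ExcludedMiddle ℓ₂
  em₂ = lowerExcludedMiddle (c ⊔ ℓ₁ ⊔ a ⊔ k) em
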